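{- Let $G$ be a finite simple graph without isolated vertices. Then the non-cover complex $\mathcal{NC}(G)$ is $(|V(G)|-i\gamma(G)-1)$-collapsible.
   Context: For a finite simple graph $G$, a cover of $G$ is a set $W\subseteq V(G)$ such that $V(G)\setminus W$ is an independent set (i.e. $W$ contains an endpoint of every edge). The non-cover complex $\mathcal{NC}(G)$ is the simplicial complex on $V(G)$ whose faces are all sets $W\subseteq V(G)$ that are not covers of $G$ (equivalently, $V(G)\setminus W$ contains both endpoints of some edge). For $A,D\subseteq V(G)$, $D$ dominates $A$ if every $v\in A$ has a neighbor in $D$; $\gamma(G;A)$ is the minimum size of a set dominating $A$. The independent domination number is $i\gamma(G)=\max\{\gamma(G;I): I \text{ an independent set of } G\}$ (with $i\gamma(G)=\infty$ if $G$ has an isolated vertex). For a finite simplicial complex $X$, a face $\sigma$ is free if exactly one facet of $X$ contains $\sigma$; an elementary $d$-collapse deletes all faces containing a given free face of size at most $d$; $X$ is $d$-collapsible if the void complex can be obtained from $X$ by a finite sequence of elementary $d$-collapses. -}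

module Defs where

open import Data.Empty using (⊥-elim)
open import Data.Fin using (Fin)
open import Data.Fin.Properties using (all?; any?)
open import Data.Fin.Subset using (Subset; _∈_; _⊆_; _⊈_; ∁; ∣_∣; ⊤; ⊥)
open import Data.Fin.Subset.Properties
  using (_∈?_; anySubset?; ∈⊤; ∉⊥; ∣p∣≤n; x∈p⇒x∉∁p; x∉p⇒x∈∁p)
open import Data.Integer using (ℤ; +_)
import Data.Integer as ℤ
open import Data.Nat using (ℕ; zero; suc; _≤_; _≟_; z≤n; s≤s)
open import Data.Nat.Properties using (m≤n⇒m<n∨m≡n)
open import Data.Product using (∃; ∃!; _×_; _,_; proj₁; proj₂)
open import Data.Sum using (inj₁; inj₂)
open import Function.Bundles using (_⇔_)
open import Level using (0ℓ)
open import Relation.Binary.Construct.Closure.ReflexiveTransitive using (Star)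
open import Relation.Binary.Core using (Rel)
import Relation.Binary.Definitions as Binary
open import Relation.Binary.PropositionalEquality using (_≡_; refl; subst)
open import Relation.Nullary using (¬_; Dec; yes; no)
open import Relation.Nullary.Decidable using (_×-dec_; _→-dec_; ¬?)
open import Relation.Unary using (Pred; Decidable)

IsMinimum : Pred ℕ 0ℓ → ℕ → Set
IsMinimum P k = P k × (∀ {j} → P j → k ≤ j)

IsMaximum : Pred ℕ 0ℓ → ℕ → Set
IsMaximum P k = P k × (∀ {j} → P j → j ≤ k)

minimum : {P : Pred ℕ 0ℓ} → Decidable P → ∃ P → ∃ (IsMinimum P)
minimum {P} P? (b , pb) = search b P? pb
  where
  search : ∀ b {Q : Pred ℕ 0ℓ} → Decidable Q → Q b → ∃ (IsMinimum Q)
  search zero    Q? q = zero , q , λ _ → z≤n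
  search (suc b) Q? q with Q? zero
  ... | yes q₀ = zero , q₀ , λ _ → z≤n
  ... | no ¬q₀ with search b (λ k → Q? (suc k)) q
  ...   | k , qk , k≤ =
          suc k , qk , λ { {zero} q₀ → ⊥-elim (¬q₀ q₀) ; {suc j} qj → s≤s (k≤ qj) }

maximum : {P : Pred ℕ 0ℓ} → Decidable P → ∃ P →
          (b : ℕ) → (∀ {j} → P j → j ≤ b) → ∃ (IsMaximum P)
maximum P? (j , pj) zero    bound with z≤n ← bound pj = zero , pj , bound
maximum {P} P? p (suc b) bound with P? (suc b)
... | yes pb = suc b , pb , bound
... | no ¬pb = maximum P? p b bound′
  where
  bound′ : ∀ {j} → P j → j ≤ b
  bound′ pj with m≤n⇒m<n∨m≡n (bound pj)
  ... | inj₁ (s≤s j≤b) = j≤b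
  ... | inj₂ refl      = ⊥-elim (¬pb pj)

record Graph (n : ℕ) : Set₁ where
  field
    Adj     : Rel (Fin n) 0ℓ
    adj?    : Binary.Decidable Adj
    symm    : Binary.Symmetric Adj
    irrefl  : Binary.Irreflexive _≡_ Adj

module _ {n : ℕ} (G : Graph n) where
  open Graph G

  NoIsolatedVertices : Set
  NoIsolatedVertices = ∀ v → ∃ λ u → Adj v u

  Independent : Pred (Subset n) 0ℓ
  Independent S = ∀ u v → u ∈ S → v ∈ S → ¬ Adj u v

  independent? : Decidable Independent
  independent? S = all? λ u → all? λ v →
    (u ∈? S) →-dec ((v ∈? S) →-dec ¬? (adj? u v))

  Cover : Pred (Subset n) 0ℓ
  Cover W = Independent (∁ W)

  -- Total domination: a vertex of D is not dominated merely by lying in D.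
  _Dominates_ : Subset n → Subset n → Set
  D Dominates A = ∀ v → v ∈ A → ∃ λ u → u ∈ D × Adj v u

  dominates? : ∀ D A → Dec (D Dominates A)
  dominates? D A = all? λ v → (v ∈? A) →-dec any? λ u → (u ∈? D) ×-dec adj? v u

  DominatingSize : Subset n → Pred ℕ 0ℓ
  DominatingSize A k = ∃ λ D → D Dominates A × ∣ D ∣ ≡ k

  dominatingSize? : ∀ A → Decidable (DominatingSize A)
  dominatingSize? A k = anySubset? λ D → dominates? D A ×-dec (∣ D ∣ ≟ k)

  -- An isolated vertex would make the domination numbers infinite; the
  -- argument of type NoIsolatedVertices is what makes them natural numbers.
  module _ (noIso : NoIsolatedVertices) where

    γ-exists : ∀ A → ∃ (IsMinimum (DominatingSize A))
    γ-exists A = minimum (dominatingSize? A)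
      (∣ ⊤ {n} ∣ , ⊤ , (λ v _ → let (u , vu) = noIso v in u , ∈⊤ , vu) , refl)

    γ : Subset n → ℕ
    γ A = proj₁ (γ-exists A)

    IndependentγValue : Pred ℕ 0ℓ
    IndependentγValue k = ∃ λ I → Independent I × γ I ≡ k

    iγ-exists : ∃ (IsMaximum IndependentγValue)
    iγ-exists = maximum
      (λ k → anySubset? λ I → independent? I ×-dec (γ I ≟ k))
      (γ ⊥ , ⊥ , (λ _ _ u∈⊥ → ⊥-elim (∉⊥ u∈⊥)) , refl)
      n
      λ { (I , _ , refl) → γ≤n I }
      where
      γ≤n : ∀ I → γ I ≤ n
      γ≤n I with (D , _ , ∣D∣≡γ) ← proj₁ (proj₂ (γ-exists I)) =
        subst (_≤ n) ∣D∣≡γ (∣p∣≤n D)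

    iγ : ℕ
    iγ = proj₁ iγ-exists

-- The void complex (no faces at all) is allowed and differs from the complex
-- whose only face is the empty set; elements of Fin n need not be vertices.
record SimplicialComplex (n : ℕ) : Set₁ where
  field
    Face       : Pred (Subset n) 0ℓ
    face?      : Decidable Face
    downClosed : ∀ {σ τ} → σ ⊆ τ → Face τ → Face σ

open SimplicialComplex

module _ {n : ℕ} where

  IsVoid : SimplicialComplex n → Set
  IsVoid X = ∀ σ → ¬ Face X σ

  Facet : SimplicialComplex n → Pred (Subset n) 0ℓ
  Facet X τ = Face X τ × (∀ {ρ} → Face X ρ → τ ⊆ ρ → τ ≡ ρ)

  Free : SimplicialComplex n → Pred (Subset n) 0ℓ
  Free X σ = Face X σ × ∃! _≡_ λ τ → Facet X τ × σ ⊆ τ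

  -- The parameter d is an integer, so that differences such as |V| − k − 1
  -- are not truncated at zero.
  ElementaryCollapse : ℤ → Rel (SimplicialComplex n) 0ℓ
  ElementaryCollapse d X Y = ∃ λ σ →
    Free X σ × (+ ∣ σ ∣) ℤ.≤ d × (∀ τ → Face Y τ ⇔ (Face X τ × σ ⊈ τ))

  -- Voidness is required of the endpoint as a property, since complexes with
  -- the same faces need not be propositionally equal.
  Collapsible : ℤ → SimplicialComplex n → Set₁
  Collapsible d X = ∃ λ Y → Star (ElementaryCollapse d) X Y × IsVoid Y

NC : ∀ {n} → Graph n → SimplicialComplex n
NC G = record
  { Face       = λ W → ¬ Cover G W
  ; face?      = λ W → ¬? (independent? G (∁ W))
  ; downClosed = λ {σ} {τ} σ⊆τ ¬cτ cσ → ¬cτ λ u v u∈ v∈ →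
      cσ u v (∁-anti σ τ σ⊆τ u∈) (∁-anti σ τ σ⊆τ v∈)
  }
  where
  ∁-anti : ∀ σ τ → σ ⊆ τ → ∁ τ ⊆ ∁ σ
  ∁-anti σ τ σ⊆τ x∈∁τ = x∉p⇒x∈∁p λ x∈σ → x∈p⇒x∉∁p (σ⊆τ x∈σ) x∈∁τ

{-# OPTIONS --safe #-}
-- For an independent set I, every face σ of NC(G) misses an edge.  Order the
-- edges so that those disjoint from I come first, and in an edge that meets I
-- list the endpoint outside I first.  Scanning the edges and branching on
-- whether the first endpoint, only the second one, or neither of them lies in σ
-- partitions the faces into intervals [A, C]; removing these intervals in the
-- order of the branches is a sequence of elementary collapses along the bottoms
-- A.  If the edge missed by such an interval is (w, a), then replacing every
-- vertex of ∁ A ∖ a lying in I by one of its neighbours gives a set that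
-- dominates I, so γ(G; I) < |∁ A|.
module Submission where

open import Defs
open import Data.Empty using (⊥-elim)
open import Data.Fin using (Fin; zero; suc)
open import Data.Fin.Properties using () renaming (_≟_ to _≟ᶠ_)
open import Data.Fin.Subset
  using (Subset; inside; outside; _∈_; _∉_; _⊆_; _⊈_; ∁; ∣_∣; ⊤; ⊥; _∪_; ⁅_⁆)
  renaming (_-_ to _∖_)
open import Data.Fin.Subset.Properties
open import Data.Integer using (ℤ; +_; _-_; 1ℤ)
import Data.Integer as ℤ
import Data.Integer.Properties as ℤₚ
open import Data.List using (List; []; _∷_; _++_; filter; cartesianProduct; allFin)
open import Data.List.Membership.Propositional using (lose) renaming (_∈_ to _∈ˡ_)
open import Data.List.Membership.Propositional.Properties
  using (∈-allFin; ∈-cartesianProduct⁺; ∈-filter⁺; ∈-++⁺ˡ; ∈-++⁺ʳ)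
open import Data.List.Relation.Unary.All as All using (All; []; _∷_)
open import Data.List.Relation.Unary.All.Properties using (all-filter; ++⁺)
open import Data.List.Relation.Unary.Any as Any using (Any; here; there)
open import Data.List.Relation.Unary.Any.Properties using (¬Any[])
open import Data.Nat using (ℕ; suc; _≤_; _<_; _+_; _∸_; z≤n; s≤s)
import Data.Nat.Properties as ℕₚ
open import Data.Product using (∃; _×_; _,_; proj₁; proj₂)
open import Data.Sum using (inj₁; inj₂)
open import Data.Vec using ([]; _∷_; here; there)
open import Function using (_∘_)
open import Function.Bundles using (_⇔_; mk⇔; Equivalence)
open import Function.Construct.Identity using (⇔-id)
open import Relation.Binary.Construct.Closure.ReflexiveTransitive using (Star; ε; _◅_; _◅◅_)
open import Relation.Binary.PropositionalEquality
open import Relation.Nullary using (¬_; yes; no)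
open import Relation.Nullary.Decidable using (_×-dec_; ¬?; decidable-stable)
open import Relation.Unary using (Decidable)

open Equivalence using (to; from)
open SimplicialComplex

-- Finite subsets and integer arithmetic.

x∉p∖x : ∀ {n} (p : Subset n) x → x ∉ p ∖ x
x∉p∖x (_ ∷ p) zero    ()
x∉p∖x (_ ∷ p) (suc x) (there x∈) = x∉p∖x p x x∈

⊆-∖ : ∀ {n} {p q : Subset n} {x} → p ⊆ q → x ∉ p → p ⊆ q ∖ x
⊆-∖ p⊆q x∉p y∈p = x∈p∧x≢y⇒x∈p-y (p⊆q y∈p) λ { refl → x∉p y∈p }

∪⁅⁆-⊆ : ∀ {n} {p q : Subset n} {x} → p ⊆ q → x ∈ q → p ∪ ⁅ x ⁆ ⊆ q
∪⁅⁆-⊆ {p = p} {x = x} p⊆q x∈q y∈ with x∈p∪q⁻ p ⁅ x ⁆ y∈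
... | inj₁ y∈p = p⊆q y∈p
... | inj₂ y∈x rewrite x∈⁅y⁆⇒x≡y x y∈x = x∈q

∣p∪q∣≤∣p∣+∣q∣ : ∀ {n} (p q : Subset n) → ∣ p ∪ q ∣ ≤ ∣ p ∣ + ∣ q ∣
∣p∪q∣≤∣p∣+∣q∣ []            []            = z≤n
∣p∪q∣≤∣p∣+∣q∣ (inside ∷ p)  (y ∷ q)       =
  s≤s (ℕₚ.≤-trans (∣p∪q∣≤∣p∣+∣q∣ p q) (ℕₚ.+-monoʳ-≤ ∣ p ∣ (∣p∣≤∣x∷p∣ y q)))
∣p∪q∣≤∣p∣+∣q∣ (outside ∷ p) (inside ∷ q)  =
  subst (suc ∣ p ∪ q ∣ ≤_) (sym (ℕₚ.+-suc ∣ p ∣ ∣ q ∣)) (s≤s (∣p∪q∣≤∣p∣+∣q∣ p q))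
∣p∪q∣≤∣p∣+∣q∣ (outside ∷ p) (outside ∷ q) = ∣p∪q∣≤∣p∣+∣q∣ p q

image : ∀ {m n} (f : Fin m → Fin n) (S : Subset m) →
  ∃ λ D → ∣ D ∣ ≤ ∣ S ∣ × (∀ {x} → x ∈ S → f x ∈ D)
image {n = n} f [] = ⊥ , ℕₚ.≤-reflexive (∣⊥∣≡0 n) , λ ()
image f (outside ∷ S) with image (f ∘ suc) S
... | D , D≤S , f∈D = D , D≤S , λ { (there x∈S) → f∈D x∈S }
image f (inside ∷ S) with image (f ∘ suc) S
... | D , D≤S , f∈D = ⁅ f zero ⁆ ∪ D , size , λ
  { here        → p⊆p∪q D (x∈⁅x⁆ (f zero))
  ; (there x∈S) → q⊆p∪q ⁅ f zero ⁆ D (f∈D x∈S)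
  }
  where
  size : ∣ ⁅ f zero ⁆ ∪ D ∣ ≤ suc ∣ S ∣
  size = ℕₚ.≤-trans (∣p∪q∣≤∣p∣+∣q∣ ⁅ f zero ⁆ D)
    (ℕₚ.+-mono-≤ (ℕₚ.≤-reflexive (∣⁅x⁆∣≡1 (f zero))) D≤S)

-- The strictness of the hypothesis pays for the final `1ℤ`. It also forces `suc k ≤ n`, so the
-- integer difference is a natural number.
suc-≤-∸⇒≤-ℤ : ∀ {n k a} → a ≤ n → k < n ∸ a → + a ℤ.≤ + n - + k - 1ℤ
suc-≤-∸⇒≤-ℤ {n} {k} {a} a≤n k<n∸a = subst (+ a ℤ.≤_) (sym eq)
  (ℤ.+≤+ (ℕₚ.m+n≤o⇒m≤o∸n a a+1+k≤n))
  where
  a+1+k≤n : a + suc k ≤ n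
  a+1+k≤n = subst (_≤ n) (ℕₚ.+-comm (suc k) a) (ℕₚ.m≤o∸n⇒m+n≤o (suc k) a≤n k<n∸a)
  open ≡-Reasoning
  eq : + n - + k - 1ℤ ≡ + (n ∸ suc k)
  eq = begin
    + n - + k - 1ℤ              ≡⟨ ℤₚ.+-assoc (+ n) (ℤ.- + k) (ℤ.- 1ℤ) ⟩
    + n ℤ.+ (ℤ.- + k ℤ.- 1ℤ)    ≡⟨ cong (λ z → + n ℤ.+ z) (ℤₚ.neg-distrib-+ (+ k) 1ℤ) ⟨
    + n - + (k + 1)             ≡⟨ cong (λ z → + n - + z) (ℕₚ.+-comm k 1) ⟩
    + n - + suc k               ≡⟨ ℤₚ.m-n≡m⊖n n (suc k) ⟩
    n ℤ.⊖ suc k                 ≡⟨ ℤₚ.⊖-≥ (ℕₚ.m+n≤o⇒n≤o a a+1+k≤n) ⟩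
    + (n ∸ suc k)               ∎

-- Removing all faces above a set by elementary collapses.

module _ {n : ℕ} where

  removeStar : SimplicialComplex n → Subset n → SimplicialComplex n
  removeStar X A = record
    { Face       = λ τ → Face X τ × A ⊈ τ
    ; face?      = λ τ → face? X τ ×-dec ¬? (A ⊆? τ)
    ; downClosed = λ σ⊆τ (fτ , A⊈τ) →
        downClosed X σ⊆τ fτ , λ A⊆σ → A⊈τ (⊆-trans A⊆σ σ⊆τ)
    }

  Misses : Subset n → Fin n × Fin n → Set
  Misses σ (w , a) = w ∉ σ × a ∉ σ

  -- `C` excludes the vertices ruled out by earlier branches; `L` holds the edges still to be
  -- scanned.
  record Within (C : Subset n) (L : List (Fin n × Fin n)) (σ : Subset n) : Set where
    constructor within
    field
      below  : σ ⊆ C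
      misses : Any (Misses σ) L

  open Within public

  StarIs : Subset n → Subset n → List (Fin n × Fin n) → SimplicialComplex n → Set
  StarIs A C L X = ∀ σ → A ⊆ σ → Face X σ ⇔ Within C L σ

  module _ (d : ℤ) where

    Removes : SimplicialComplex n → Subset n → Set₁
    Removes X A = ∃ λ Y → Star (ElementaryCollapse d) X Y ×
      (∀ τ → Face Y τ ⇔ (Face X τ × A ⊈ τ))

    -- Quantifying over `X` lets the branches run one after another, each on the complex left by the
    -- previous one; only the faces above `A` are prescribed.
    Removable : Subset n → Subset n → List (Fin n × Fin n) → Set₁
    Removable A C L = ∀ X → StarIs A C L X → Removes X A

    remove-empty : ∀ {X A} → (∀ σ → A ⊆ σ → ¬ Face X σ) → Removes X A
    remove-empty {X} {A} none = X , ε , λ τ →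
      mk⇔ (λ f → f , λ (A⊆τ : A ⊆ τ) → none τ A⊆τ f) proj₁

    removable-[] : ∀ A C → Removable A C []
    removable-[] A C X star = remove-empty λ σ A⊆σ f → ¬Any[] (misses (to (star σ A⊆σ) f))

    -- If `A ⊆ T`, then `T` is the only facet above `A`, so `A` is free. Otherwise, for instance
    -- when an endpoint of the scanned edge already lies in `A`, there is nothing to collapse; hence
    -- the size bound is conditional.
    remove-interval : ∀ {X A T} → (A ⊆ T → + ∣ A ∣ ℤ.≤ d) →
      (∀ σ → A ⊆ σ → Face X σ ⇔ σ ⊆ T) → Removes X A
    remove-interval {X} {A} {T} size star with A ⊆? T
    ... | no  A⊈T = remove-empty λ σ A⊆σ f → A⊈T (⊆-trans A⊆σ (to (star σ A⊆σ) f))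
    ... | yes A⊆T = removeStar X A , (A , free , size A⊆T , λ _ → ⇔-id _) ◅ ε , λ _ → ⇔-id _
      where
      faceT : Face X T
      faceT = from (star T A⊆T) ⊆-refl
      facetT : Facet X T
      facetT = faceT , λ {ρ} fρ T⊆ρ → ⊆-antisym T⊆ρ (to (star ρ (⊆-trans A⊆T T⊆ρ)) fρ)
      unique : ∀ {τ} → Facet X τ × A ⊆ τ → T ≡ τ
      unique {τ} ((fτ , maximal) , A⊆τ) = sym (maximal faceT (to (star τ A⊆τ) fτ))
      free : Free X A
      free = from (star A ⊆-refl) A⊆T , T , (facetT , A⊆T) , unique

    -- A face above `A` contains `w`, or `a` but not `w`, or neither. In the first two cases the
    -- missed edge must come from `L`; in the last, `(w , a)` itself is missed, so these faces fill
    -- the whole interval from `A` to `C ∖ w ∖ a`.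
    removable-∷ : ∀ {A C w a L} →
      Removable (A ∪ ⁅ w ⁆) C L →
      Removable (A ∪ ⁅ a ⁆) (C ∖ w) L →
      (A ⊆ C ∖ w ∖ a → + ∣ A ∣ ℤ.≤ d) →
      Removable A C ((w , a) ∷ L)
    removable-∷ {A} {C} {w} {a} {L} rem-w rem-a size X star
      with rem-w X star-w
      where
      A⊆ : ∀ {σ} → A ∪ ⁅ w ⁆ ⊆ σ → A ⊆ σ
      A⊆ = ⊆-trans (p⊆p∪q ⁅ w ⁆)
      star-w : StarIs (A ∪ ⁅ w ⁆) C L X
      star-w σ Aw⊆σ = mk⇔
        (λ f → let p = to (star σ (A⊆ Aw⊆σ)) f in
          within (below p)
            (Any.tail (λ (w∉σ , _) → w∉σ (Aw⊆σ (q⊆p∪q A ⁅ w ⁆ (x∈⁅x⁆ w)))) (misses p)))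
        (λ p → from (star σ (A⊆ Aw⊆σ)) (within (below p) (there (misses p))))
    -- No remaining face above `A` contains `w`, so the upper bound shrinks to `C ∖ w`.
    ... | X₁ , X↠X₁ , X₁⇔ with rem-a X₁ star-a
      where
      A⊆ : ∀ {σ} → A ∪ ⁅ a ⁆ ⊆ σ → A ⊆ σ
      A⊆ = ⊆-trans (p⊆p∪q ⁅ a ⁆)
      star-a : StarIs (A ∪ ⁅ a ⁆) (C ∖ w) L X₁
      star-a σ Aa⊆σ = mk⇔
        (λ f₁ → let (f , Aw⊈σ) = to (X₁⇔ σ) f₁
                    p = to (star σ (A⊆ Aa⊆σ)) f in
          within
            (⊆-∖ (below p) (λ w∈σ → Aw⊈σ (∪⁅⁆-⊆ (A⊆ Aa⊆σ) w∈σ)))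
            (Any.tail (λ (_ , a∉σ) → a∉σ (Aa⊆σ (q⊆p∪q A ⁅ a ⁆ (x∈⁅x⁆ a)))) (misses p)))
        (λ p → from (X₁⇔ σ)
          ( from (star σ (A⊆ Aa⊆σ))
              (within (⊆-trans (below p) (p─q⊆p C ⁅ w ⁆)) (there (misses p)))
          , λ Aw⊆σ → x∉p∖x C w (below p (Aw⊆σ (q⊆p∪q A ⁅ w ⁆ (x∈⁅x⁆ w))))))
    ... | X₂ , X₁↠X₂ , X₂⇔ with remove-interval {X₂} size star-A
      where
      star-A : ∀ σ → A ⊆ σ → Face X₂ σ ⇔ σ ⊆ C ∖ w ∖ a
      star-A σ A⊆σ = mk⇔ {B = σ ⊆ C ∖ w ∖ a}
        (λ f₂ → let (f₁ , Aa⊈σ) = to (X₂⇔ σ) f₂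
                    (f , Aw⊈σ) = to (X₁⇔ σ) f₁ in
          ⊆-∖ (⊆-∖ (below (to (star σ A⊆σ) f)) (λ w∈σ → Aw⊈σ (∪⁅⁆-⊆ A⊆σ w∈σ)))
              (λ a∈σ → Aa⊈σ (∪⁅⁆-⊆ A⊆σ a∈σ)))
        (λ σ⊆T →
          let w∉σ : w ∉ σ
              w∉σ w∈σ = x∉p∖x C w (p─q⊆p (C ∖ w) ⁅ a ⁆ (σ⊆T w∈σ))
              a∉σ : a ∉ σ
              a∉σ a∈σ = x∉p∖x (C ∖ w) a (σ⊆T a∈σ)
          in from (X₂⇔ σ)
            ( from (X₁⇔ σ)
              ( from (star σ A⊆σ)
                (within (⊆-trans σ⊆T (⊆-trans (p─q⊆p (C ∖ w) ⁅ a ⁆) (p─q⊆p C ⁅ w ⁆)))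
                        (here (w∉σ , a∉σ)))
              , λ Aw⊆σ → w∉σ (Aw⊆σ (q⊆p∪q A ⁅ w ⁆ (x∈⁅x⁆ w))))
            , λ Aa⊆σ → a∉σ (Aa⊆σ (q⊆p∪q A ⁅ a ⁆ (x∈⁅x⁆ a)))))
    ... | Y , X₂↠Y , Y⇔ = Y , X↠X₁ ◅◅ X₁↠X₂ ◅◅ X₂↠Y , λ τ → mk⇔
      (λ fY → let (f₂ , A⊈τ) = to (Y⇔ τ) fY in
        proj₁ (to (X₁⇔ τ) (proj₁ (to (X₂⇔ τ) f₂))) , A⊈τ)
      (λ (f , A⊈τ) → from (Y⇔ τ)
        ( from (X₂⇔ τ)
          ( from (X₁⇔ τ) (f , λ Aw⊆τ → A⊈τ (⊆-trans (p⊆p∪q ⁅ w ⁆) Aw⊆τ))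
          , λ Aa⊆τ → A⊈τ (⊆-trans (p⊆p∪q ⁅ a ⁆) Aa⊆τ))
        , A⊈τ))

-- Domination bounds and the scan of the edges.

module _ {n : ℕ} (G : Graph n) (noIso : NoIsolatedVertices G)
         (I : Subset n) (indep : Independent G I) where
  open Graph G

  γ-minimal : ∀ D → _Dominates_ G D I → γ G noIso I ≤ ∣ D ∣
  γ-minimal D dom = proj₂ (proj₂ (γ-exists G noIso I)) (D , dom , refl)

  leaveI : Fin n → Fin n
  leaveI v with v ∈? I
  ... | yes _ = proj₁ (noIso v)
  ... | no  _ = v

  leaveI-∈ : ∀ {v} → v ∈ I → Adj v (leaveI v)
  leaveI-∈ {v} v∈I with v ∈? I
  ... | yes _   = proj₂ (noIso v)
  ... | no  v∉I = ⊥-elim (v∉I v∈I)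

  leaveI-∉ : ∀ {v} → v ∉ I → leaveI v ≡ v
  leaveI-∉ {v} v∉I with v ∈? I
  ... | yes v∈I = ⊥-elim (v∉I v∈I)
  ... | no  _   = refl

  -- A vertex of `I` in `A` is dominated through `outer`, the vertex `a` (if in `I`) by `w`, and any
  -- other by its own replacement. Leaving out `a` makes the inequality strict.
  γ<∣∁∣ : ∀ {A w a} → Adj w a → w ∉ A → a ∉ A →
    (∀ {v} → v ∈ A → v ∈ I → ∃ λ u → u ∉ A × u ≢ a × Adj v u) →
    γ G noIso I < ∣ ∁ A ∣
  γ<∣∁∣ {A} {w} {a} wa w∉A a∉A outer with image leaveI (∁ A ∖ a)
  ... | D , ∣D∣≤ , leaveI∈D =
    ℕₚ.≤-<-trans (ℕₚ.≤-trans (γ-minimal D dominates) ∣D∣≤) (x∈p⇒∣p-x∣<∣p∣ (x∉p⇒x∈∁p a∉A))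
    where
    -- A neighbour of a vertex of `I` lies outside `I`, so `leaveI` fixes it.
    neighbour∈D : ∀ {v u} → v ∈ I → Adj v u → u ∉ A → u ≢ a → u ∈ D
    neighbour∈D v∈I vu u∉A u≢a = subst (_∈ D) (leaveI-∉ λ u∈I → indep _ _ v∈I u∈I vu)
      (leaveI∈D (x∈p∧x≢y⇒x∈p-y (x∉p⇒x∈∁p u∉A) u≢a))

    dominates : _Dominates_ G D I
    dominates v v∈I with v ≟ᶠ a | v ∈? A
    ... | yes refl | _ =
      w , neighbour∈D v∈I (symm wa) w∉A (λ w≡a → irrefl w≡a wa) , symm wa
    ... | no _   | yes v∈A with outer v∈A v∈I
    ...   | u , u∉A , u≢a , vu = u , neighbour∈D v∈I vu u∉A u≢a , vu
    dominates v v∈I | no v≢a | no v∉A =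
      leaveI v , leaveI∈D (x∈p∧x≢y⇒x∈p-y (x∉p⇒x∈∁p v∉A) v≢a) , leaveI-∈ v∈I

  d : ℤ
  d = + n - + γ G noIso I - 1ℤ

  size-bound : ∀ {A C w a} → Adj w a → A ⊆ C ∖ w ∖ a →
    (∀ {v} → v ∈ A → v ∈ I → ∃ λ u → u ∉ C ∖ w × u ≢ a × Adj v u) →
    + ∣ A ∣ ℤ.≤ d
  size-bound {A} {C} {w} {a} wa A⊆ outer =
    suc-≤-∸⇒≤-ℤ (∣p∣≤n A) (subst (_ <_) (∣∁p∣≡n∸∣p∣ A)
      (γ<∣∁∣ wa (λ w∈A → x∉p∖x C w (A⊆C∖w w∈A)) (λ a∈A → x∉p∖x (C ∖ w) a (A⊆ a∈A))
        λ v∈A v∈I → let (u , u∉ , u≢a , vu) = outer v∈A v∈I in u , u∉ ∘ A⊆C∖w , u≢a , vu))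
    where
    A⊆C∖w : A ⊆ C ∖ w
    A⊆C∖w = ⊆-trans A⊆ (p─q⊆p (C ∖ w) ⁅ a ⁆)

  Avoiding Crossing : Fin n × Fin n → Set
  Avoiding (w , a) = Adj w a × w ∉ I × a ∉ I
  Crossing (w , a) = Adj w a × w ∉ I × a ∈ I

  avoiding? : Decidable Avoiding
  avoiding? (w , a) = adj? w a ×-dec (¬? (w ∈? I) ×-dec ¬? (a ∈? I))

  crossing? : Decidable Crossing
  crossing? (w , a) = adj? w a ×-dec (¬? (w ∈? I) ×-dec (a ∈? I))

  -- The scan keeps a neighbour outside `C` for every vertex of `A` in `I`. A vertex `a` of `I`
  -- enters `A` only in the branch where `w` leaves the bound, and then `w` is its witness; old
  -- witnesses survive because the bound only shrinks.
  removable-crossing : ∀ {A C L} → All Crossing L →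
    (∀ {v} → v ∈ A → v ∈ I → ∃ λ u → u ∉ C × Adj v u) → Removable d A C L
  removable-crossing {A} {C} [] outer = removable-[] d A C
  removable-crossing {A} {C} {(w , a) ∷ L} ((wa , w∉I , a∈I) ∷ cs) outer =
    removable-∷ d (removable-crossing cs outer-w) (removable-crossing cs outer-a)
      λ A⊆ → size-bound {C = C} wa A⊆ λ v∈A v∈I → let (u , u∉C , vu) = outer v∈A v∈I in
        -- `u` is adjacent to `v`, while `v` and `a` both lie in `I`.
        u , u∉C ∘ p─q⊆p C ⁅ w ⁆ , (λ { refl → indep _ _ v∈I a∈I vu }) , vu
    where
    outer-w : ∀ {v} → v ∈ A ∪ ⁅ w ⁆ → v ∈ I → ∃ λ u → u ∉ C × Adj v u
    outer-w v∈ v∈I with x∈p∪q⁻ A ⁅ w ⁆ v∈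
    ... | inj₁ v∈A = outer v∈A v∈I
    ... | inj₂ v∈w = ⊥-elim (w∉I (subst (_∈ I) (x∈⁅y⁆⇒x≡y w v∈w) v∈I))

    outer-a : ∀ {v} → v ∈ A ∪ ⁅ a ⁆ → v ∈ I → ∃ λ u → u ∉ C ∖ w × Adj v u
    outer-a v∈ v∈I with x∈p∪q⁻ A ⁅ a ⁆ v∈
    ... | inj₁ v∈A = let (u , u∉C , vu) = outer v∈A v∈I in u , u∉C ∘ p─q⊆p C ⁅ w ⁆ , vu
    ... | inj₂ v∈a rewrite x∈⁅y⁆⇒x≡y a v∈a = w , x∉p∖x C w , symm wa

  -- Only vertices outside `I` are added to `A` here, so the invariant of `removable-crossing` holds
  -- vacuously when the crossing edges begin.
  removable-avoiding : ∀ {A C K L} → All Avoiding K → All Crossing L →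
    (∀ {v} → v ∈ A → v ∉ I) → Removable d A C (K ++ L)
  removable-avoiding [] cs A∩I=∅ =
    removable-crossing cs λ v∈A v∈I → ⊥-elim (A∩I=∅ v∈A v∈I)
  removable-avoiding {A} {C} {(w , a) ∷ K} ((wa , w∉I , a∉I) ∷ as) cs A∩I=∅ =
    removable-∷ d (removable-avoiding as cs (extend w∉I)) (removable-avoiding as cs (extend a∉I))
      λ A⊆ → size-bound {C = C} wa A⊆ λ v∈A v∈I → ⊥-elim (A∩I=∅ v∈A v∈I)
    where
    extend : ∀ {x} → x ∉ I → ∀ {v} → v ∈ A ∪ ⁅ x ⁆ → v ∉ I
    extend {x} x∉I v∈ with x∈p∪q⁻ A ⁅ x ⁆ v∈
    ... | inj₁ v∈A = A∩I=∅ v∈A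
    ... | inj₂ v∈x rewrite x∈⁅y⁆⇒x≡y x v∈x = x∉I

  -- Avoiding edges occur in both orientations. This is harmless: past the first occurrence an
  -- endpoint lies in `A`, so the second one yields an empty interval.
  pairs edges : List (Fin n × Fin n)
  pairs = cartesianProduct (allFin n) (allFin n)
  edges = filter avoiding? pairs ++ filter crossing? pairs

  ∈-pairs : ∀ e → e ∈ˡ pairs
  ∈-pairs (w , a) = ∈-cartesianProduct⁺ (∈-allFin w) (∈-allFin a)

  edges-adjacent : All (λ (w , a) → Adj w a) edges
  edges-adjacent = ++⁺ (All.map proj₁ (all-filter avoiding? pairs))
                       (All.map proj₁ (all-filter crossing? pairs))

  misses-edge : ∀ {σ u v} → Adj u v → u ∉ σ → v ∉ σ → Any (Misses σ) edges
  misses-edge {σ} {u} {v} uv u∉σ v∉σ with u ∈? I | v ∈? I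
  ... | yes u∈I | yes v∈I = ⊥-elim (indep u v u∈I v∈I uv)
  ... | yes u∈I | no  v∉I = lose (∈-++⁺ʳ (filter avoiding? pairs)
    (∈-filter⁺ crossing? (∈-pairs (v , u)) (symm uv , v∉I , u∈I))) (v∉σ , u∉σ)
  ... | no  u∉I | yes v∈I = lose (∈-++⁺ʳ (filter avoiding? pairs)
    (∈-filter⁺ crossing? (∈-pairs (u , v)) (uv , u∉I , v∈I))) (u∉σ , v∉σ)
  ... | no  u∉I | no  v∉I = lose (∈-++⁺ˡ
    (∈-filter⁺ avoiding? (∈-pairs (u , v)) (uv , u∉I , v∉I))) (u∉σ , v∉σ)

  NC-star-⊥ : StarIs ⊥ ⊤ edges (NC G)
  NC-star-⊥ σ _ = mk⇔
    (λ ¬cover → within (⊆-max σ) (decidable-stable (Any.any? misses? edges) λ ¬miss →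
      ¬cover λ u v u∈ v∈ uv → ¬miss (misses-edge uv (x∈∁p⇒x∉p u∈) (x∈∁p⇒x∉p v∈))))
    (λ p cover → let (wa , w∉σ , a∉σ) = All.lookupAny edges-adjacent (misses p) in
      cover _ _ (x∉p⇒x∈∁p w∉σ) (x∉p⇒x∈∁p a∉σ) wa)
    where
    misses? : Decidable (Misses σ)
    misses? (w , a) = ¬? (w ∈? σ) ×-dec ¬? (a ∈? σ)

  NC-collapsible : Collapsible d (NC G)
  -- Every set contains `⊥`, so removing all faces above `⊥` leaves the void complex.
  NC-collapsible with removable-avoiding {A = ⊥}
    (all-filter avoiding? pairs) (all-filter crossing? pairs)
    (λ v∈⊥ → ⊥-elim (∉⊥ v∈⊥)) (NC G) NC-star-⊥
  ... | Y , NC↠Y , Y⇔ = Y , NC↠Y , λ σ f → proj₂ (to (Y⇔ σ) f) (⊆-min σ)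

theorem1p2 : ∀ (n : ℕ) (G : Graph n) (noIso : NoIsolatedVertices G) →
    Collapsible ((+ n) - (+ (iγ G noIso)) - 1ℤ) (NC G)
-- Each independent set gives a bound; one attaining the maximum gives the smallest parameter.
theorem1p2 n G noIso with (I , indep , γI≡iγ) ← proj₁ (proj₂ (iγ-exists G noIso)) =
  subst (λ k → Collapsible (+ n - + k - 1ℤ) (NC G)) γI≡iγ (NC-collapsible G noIso I indep)
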